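{- Let $n\ge 5$ be an odd integer and let $M$ be a perfect matching of the flower snark $\mathcal{F}_n$. Then $\mathcal{F}_n+M$ is Class I.
   Context: For odd $n\ge 3$, the flower snark $\mathcal{F}_n$ is the cubic graph on the $4n$ vertices $a_i,b_i,c_i,d_i$ ($i\in\mathbb{Z}/n\mathbb{Z}$) with edges $a_ib_i,\ a_ic_i,\ a_id_i$ (a star centred at $a_i$) and $b_ib_{i+1},\ c_id_{i+1},\ d_ic_{i+1}$ for every $i\in\mathbb{Z}/n\mathbb{Z}$. For a perfect matching $M$ of a graph $G$, $G+M$ denotes the multigraph obtained from $G$ by adding one parallel edge to every edge in $M$. A multigraph is Class I if its chromatic index equals its maximum degree (so for $\mathcal{F}_n+M$ this means it is properly $4$-edge-colourable). -}

module Defs where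

open import Data.Bool.Base using (Bool; T)
open import Data.Fin.Base using (Fin; toℕ)
open import Data.Fin.Properties using (toℕ-fromℕ<; toℕ<n)
open import Data.Nat.Base using (ℕ; suc; _≤_; _<_)
open import Data.Nat.DivMod using (_mod_; _%_; m<n⇒m%n≡m; n%n≡0; m%n<n)
open import Data.Nat.Properties using (m≤n⇒m<n∨m≡n; 1+n≢n; n≤1+n; ≤-trans; <⇒≢)
open import Data.Product using (Σ-syntax; ∃-syntax; ∃!; _×_; proj₁)
open import Data.Sum.Base using (_⊎_; inj₁; inj₂; [_,_]′)
open import Function.Base using (_∘_)
open import Function.Bundles using (_↔_)
open import Relation.Nullary.Negation.Core using (¬_)
open import Relation.Binary.PropositionalEquality
  using (_≡_; _≢_; refl; sym; trans; cong)

-- Edges are abstract, so that parallel edges are distinct elements of Edge.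
-- Graphs are undirected: the order of the two ends carries no meaning.
record Multigraph : Set₁ where
  field
    Vertex   : Set
    Edge     : Set
    end₁     : Edge → Vertex
    end₂     : Edge → Vertex
    loopless : ∀ e → end₁ e ≢ end₂ e

  Incident : Vertex → Edge → Set
  Incident v e = v ≡ end₁ e ⊎ v ≡ end₂ e

  -- As there are no loops, each edge at v is incident with v through exactly
  -- one of its ends and so is counted once.
  HasDegree : Vertex → ℕ → Set
  HasDegree v k = (Σ[ e ∈ Edge ] Incident v e) ↔ Fin k

  IsMaxDegree : ℕ → Set
  IsMaxDegree Δ = (∃[ v ] HasDegree v Δ) × (∀ v → ∃[ k ] HasDegree v k × k ≤ Δ)

  ProperEdgeColouring : ∀ {k} → (Edge → Fin k) → Set
  ProperEdgeColouring c =
    ∀ {v e f} → Incident v e → Incident v f → e ≢ f → c e ≢ c f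

  EdgeColourable : ℕ → Set
  EdgeColourable k = Σ[ c ∈ (Edge → Fin k) ] ProperEdgeColouring c

  IsChromaticIndex : ℕ → Set
  IsChromaticIndex k = EdgeColourable k × (∀ j → EdgeColourable j → k ≤ j)

  ClassI : Set
  ClassI = ∃[ k ] IsChromaticIndex k × IsMaxDegree k

  EdgeSet : Set
  EdgeSet = Edge → Bool

  PerfectMatching : EdgeSet → Set
  PerfectMatching M = ∀ v → ∃! _≡_ λ e → T (M e) × Incident v e

open Multigraph public
  using (EdgeSet; PerfectMatching; ClassI)

infixl 6 _⊕_

_⊕_ : (G : Multigraph) → EdgeSet G → Multigraph
G ⊕ M = record
  { Vertex   = Vertex
  ; Edge     = Edge ⊎ (Σ[ e ∈ Edge ] T (M e))
  ; end₁     = [ end₁ , end₁ ∘ proj₁ ]′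
  ; end₂     = [ end₂ , end₂ ∘ proj₁ ]′
  ; loopless = λ { (inj₁ e) → loopless e ; (inj₂ e) → loopless (proj₁ e) }
  }
  where open Multigraph G using (Vertex; Edge; end₁; end₂; loopless)

-- i ↦ i + 1 in ℤ/nℤ, represented by Fin n.
next : ∀ {n} → Fin n → Fin n
next {suc n} i = suc (toℕ i) mod suc n

next-≢ : ∀ {n} → 2 ≤ n → (i : Fin n) → i ≢ next i
next-≢ {suc n} 2≤n i i≡next = [ not-last , last ]′ (m≤n⇒m<n∨m≡n (toℕ<n i))
  where
  i≡1+i%n : toℕ i ≡ suc (toℕ i) % suc n
  i≡1+i%n = trans (cong toℕ i≡next) (toℕ-fromℕ< (m%n<n (suc (toℕ i)) (suc n)))

  not-last : ¬ (suc (toℕ i) < suc n)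
  not-last 1+i<n = 1+n≢n (sym (trans i≡1+i%n (m<n⇒m%n≡m 1+i<n)))

  last : suc (toℕ i) ≢ suc n
  last 1+i≡n = <⇒≢ 2≤n (trans (cong suc (sym i≡0)) 1+i≡n)
    where
    i≡0 : toℕ i ≡ 0
    i≡0 = trans i≡1+i%n (trans (cong (_% suc n) 1+i≡n) (n%n≡0 (suc n)))

data FlowerVertex (n : ℕ) : Set where
  a b c d : Fin n → FlowerVertex n

-- For n ≥ 3 the 6n edges below have pairwise different pairs of ends, so
-- indexing them this way describes a simple graph.
data FlowerEdge (n : ℕ) : Set where
  ab ac ad : Fin n → FlowerEdge n
  bb cd dc : Fin n → FlowerEdge n

flowerEnd₁ flowerEnd₂ : ∀ {n} → FlowerEdge n → FlowerVertex n

flowerEnd₁ (ab i) = a i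
flowerEnd₁ (ac i) = a i
flowerEnd₁ (ad i) = a i
flowerEnd₁ (bb i) = b i
flowerEnd₁ (cd i) = c i
flowerEnd₁ (dc i) = d i

flowerEnd₂ (ab i) = b i
flowerEnd₂ (ac i) = c i
flowerEnd₂ (ad i) = d i
flowerEnd₂ (bb i) = b (next i)
flowerEnd₂ (cd i) = d (next i)
flowerEnd₂ (dc i) = c (next i)

flowerLoopless : ∀ {n} → 3 ≤ n → (e : FlowerEdge n) → flowerEnd₁ e ≢ flowerEnd₂ e
flowerLoopless 3≤n (ab i) ()
flowerLoopless 3≤n (ac i) ()
flowerLoopless 3≤n (ad i) ()
flowerLoopless 3≤n (bb i) eq = next-≢ (≤-trans (n≤1+n 2) 3≤n) i (b-injective eq)
  where
  b-injective : ∀ {n} {i j : Fin n} → b i ≡ b j → i ≡ j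
  b-injective refl = refl
flowerLoopless 3≤n (cd i) ()
flowerLoopless 3≤n (dc i) ()

flowerSnark : (n : ℕ) → 3 ≤ n → Multigraph
flowerSnark n 3≤n = record
  { Vertex   = FlowerVertex n
  ; Edge     = FlowerEdge n
  ; end₁     = flowerEnd₁
  ; end₂     = flowerEnd₂
  ; loopless = flowerLoopless 3≤n
  }

{-# OPTIONS --safe #-}
-- G + M is 4-edge-colourable as soon as G has a proper 4-edge-colouring in which
-- the two ends of every edge of M miss the same colour: use it for the copy.
-- Each star is met by exactly two links of M. If some two consecutive stars are
-- not joined by exactly one link of M, then the numbers of such links alternate
-- between 0 and 2, which is impossible around an odd cycle.
-- So between consecutive stars the four colours of G + M can be required to be
-- all different on the three links and the copy of one of them, and a star
-- permutes them. By default M has one colour, its copies a second one, and the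
-- other two alternate along the 2-factor complementary to M. This is a
-- 3-edge-colouring of the flower snark, so it fails to close up, but only by a
-- swap of the two alternating colours. Other permutations at four consecutive
-- stars, which are available for every shape of M, undo the swap.
module Submission where

open import Defs
open import Data.Bool.Base using (Bool; true; false; T; _xor_)
open import Data.Bool.Properties using (T-irrelevant)
open import Data.Fin using (Fin; zero; suc; toℕ; opposite)
open import Data.Fin.Patterns using (0F; 1F; 2F; 3F)
open import Data.Fin.Properties
  using (_≟_; all?; suc-injective; 0≢1+n; <⇒≢; pigeonhole; ¬∀⟶∃¬; injective⇒≤; +↔⊎;
         toℕ<n; toℕ-fromℕ<; toℕ-injective)
open import Data.Nat using (ℕ; zero; suc; s≤s; _+_; _*_; _/_; _≤_; _%_)
open import Data.Nat.DivMod
  using (_mod_; m%n<n; m<n⇒m%n≡m; n%n≡0; m%n%n≡m%n; [m+n]%n≡m%n; %-distribˡ-+;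
         m≡m%n+[m/n]*n)
open import Data.Nat.Properties
  using (≤-refl; ≤-trans; m≤n+m; n<1+n; m≤n⇒m<n∨m≡n; +-suc; +-comm)
open import Data.Product using (Σ-syntax; ∃-syntax; _×_; _,_; proj₁; proj₂)
open import Data.Sum.Base using (_⊎_; inj₁; inj₂)
open import Data.Sum.Function.Propositional using (_⊎-↔_)
open import Data.Vec.Functional using ([]; _∷_)
open import Function.Base using (_∘_; id)
open import Function.Bundles using (_↔_; mk↔ₛ′; module Inverse)
open import Function.Construct.Composition using (_↔-∘_)
open import Function.Construct.Symmetry using (↔-sym)
open import Function.Definitions using (Injective)
open import Relation.Nullary using (Dec; ¬_; yes; no; contradiction; _→-dec_; _×-dec_; ¬?)
open import Relation.Nullary.Decidable using (map′; from-yes; decidable-stable)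
open import Relation.Binary.PropositionalEquality
  using (_≡_; _≢_; _≗_; refl; sym; trans; cong; cong₂; subst; module ≡-Reasoning)

-- Multigraphs with a perfect matching doubled

module Colouring (G : Multigraph) where
  open Multigraph G hiding (EdgeSet; PerfectMatching; ClassI)

  incident-irrelevant : ∀ {v e} (p q : Incident v e) → p ≡ q
  incident-irrelevant     (inj₁ refl) (inj₁ refl) = refl
  incident-irrelevant {e = e} (inj₁ p) (inj₂ q) = contradiction (trans (sym p) q) (loopless e)
  incident-irrelevant {e = e} (inj₂ p) (inj₁ q) = contradiction (trans (sym q) p) (loopless e)
  incident-irrelevant     (inj₂ refl) (inj₂ refl) = refl

  edgeAt-≡ : ∀ {v} {x y : Σ[ e ∈ Edge ] Incident v e} → proj₁ x ≡ proj₁ y → x ≡ y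
  edgeAt-≡ {x = _ , p} {_ , q} refl = cong (_ ,_) (incident-irrelevant p q)

  degree≤colours : ∀ {v k j} → HasDegree v k → EdgeColourable j → k ≤ j
  degree≤colours deg (f , proper) = injective⇒≤ f∘edge-injective
    where
    open Inverse deg

    f∘edge-injective : Injective _≡_ _≡_ (f ∘ proj₁ ∘ from)
    f∘edge-injective {x} {y} eq with x ≟ y
    ... | yes x≡y = x≡y
    ... | no  x≢y = contradiction eq (proper (proj₂ (from x)) (proj₂ (from y)) λ ex≡ey →
            x≢y (trans (sym (strictlyInverseˡ x))
                  (trans (cong to (edgeAt-≡ ex≡ey)) (strictlyInverseˡ y))))

  regular⇒ClassI : ∀ {k} → Vertex → (∀ v → HasDegree v k) → EdgeColourable k → ClassI G
  regular⇒ClassI {k} v regular colourable =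
    k , (colourable , λ _ → degree≤colours (regular v)) ,
    (v , regular v) , λ u → k , regular u , ≤-refl

  record EdgesAt (v : Vertex) (k : ℕ) : Set where
    field
      edge       : Fin k → Edge
      incident   : ∀ i → Incident v (edge i)
      index      : ∀ {e} → Incident v e → Fin k
      edge-index : ∀ {e} (p : Incident v e) → edge (index p) ≡ e
      index-edge : ∀ i → index (incident i) ≡ i

    hasDegree : HasDegree v k
    hasDegree = mk↔ₛ′ (index ∘ proj₂) (λ i → edge i , incident i) index-edge
                  (λ x → edgeAt-≡ (edge-index (proj₂ x)))

  open EdgesAt public

module Doubling (G : Multigraph) (M : EdgeSet G) (pm : PerfectMatching G M) where
  open Multigraph G hiding (EdgeSet; PerfectMatching; ClassI)
  open Colouring G
  module G⊕M = Multigraph (G ⊕ M)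

  partner : Vertex → Edge
  partner v = proj₁ (pm v)

  partner-M : ∀ v → T (M (partner v))
  partner-M v = proj₁ (proj₁ (proj₂ (pm v)))

  partner-incident : ∀ v → Incident v (partner v)
  partner-incident v = proj₂ (proj₁ (proj₂ (pm v)))

  partner-unique : ∀ {v e} → T (M e) → Incident v e → partner v ≡ e
  partner-unique {v} Me v∈e = proj₂ (proj₂ (pm v)) (Me , v∈e)

  copy-≡ : ∀ {v} {x y : Σ[ e ∈ Σ[ e ∈ Edge ] T (M e) ] Incident v (proj₁ e)} →
    proj₁ (proj₁ x) ≡ proj₁ (proj₁ y) → x ≡ y
  copy-≡ {x = (e , p) , i} {(_ , q) , j} refl
    with T-irrelevant p q | edgeAt-≡ {x = e , i} {e , j} refl
  ... | refl | refl = refl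

  copies : ∀ v → (Σ[ e ∈ Σ[ e ∈ Edge ] T (M e) ] Incident v (proj₁ e)) ↔ Fin 1
  copies v = mk↔ₛ′ (λ _ → zero) (λ _ → (partner v , partner-M v) , partner-incident v)
    (λ { zero → refl ; (suc ()) }) (λ { ((_ , Me) , v∈e) → copy-≡ (partner-unique Me v∈e) })

  hasDegree-⊕ : ∀ {v k} → HasDegree v k → G⊕M.HasDegree v (k + 1)
  hasDegree-⊕ {v} deg = ↔-sym +↔⊎ ↔-∘ ((deg ⊎-↔ copies v) ↔-∘ split)
    where
    split : (Σ[ e ∈ G⊕M.Edge ] G⊕M.Incident v e) ↔
            ((Σ[ e ∈ Edge ] Incident v e) ⊎
             (Σ[ e ∈ Σ[ e ∈ Edge ] T (M e) ] Incident v (proj₁ e)))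
    split = mk↔ₛ′
      (λ { (inj₁ e , p) → inj₁ (e , p) ; (inj₂ e , p) → inj₂ (e , p) })
      (λ { (inj₁ (e , p)) → inj₁ e , p ; (inj₂ (e , p)) → inj₂ e , p })
      (λ { (inj₁ _) → refl ; (inj₂ _) → refl })
      (λ { (inj₁ _ , _) → refl ; (inj₂ _ , _) → refl })

  mate : ∀ {v k} → EdgesAt v k → Fin k
  mate {v} star = index star (partner-incident v)

  mate-M : ∀ {v k} (star : EdgesAt v k) → T (M (edge star (mate star)))
  mate-M {v} star = subst (T ∘ M) (sym (edge-index star (partner-incident v))) (partner-M v)

  mate-unique : ∀ {v k} (star : EdgesAt v k) {i} → T (M (edge star i)) → i ≡ mate star
  mate-unique star {i} Mi = trans (sym (index-edge star i))
    (cong (index star ∘ proj₂) (edgeAt-≡ (sym (partner-unique Mi (incident star i)))))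

  -- Injectivity of the palette at `v` says at once that `f` is proper there and that `miss v` is
  -- absent. A copy takes the colour missed at both of its ends.
  colourable-⊕ : ∀ {k l} (stars : ∀ v → EdgesAt v l)
    (f : Edge → Fin k) (miss : Vertex → Fin k) →
    (∀ v → Injective _≡_ _≡_ (miss v ∷ f ∘ edge (stars v))) →
    (∀ {e} → T (M e) → miss (end₁ e) ≡ miss (end₂ e)) →
    G⊕M.EdgeColourable k
  colourable-⊕ stars f miss palette-injective miss-M = colour , colour-proper
    where
    edge≡ : ∀ {v e} (p : Incident v e) → f (edge (stars v) (index (stars v) p)) ≡ f e
    edge≡ {v} p = cong f (edge-index (stars v) p)

    proper : ProperEdgeColouring f
    proper {v} p q e≢e′ fe≡fe′ = e≢e′
      (trans (sym (edge-index (stars v) p))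
        (trans (cong (edge (stars v))
                 (suc-injective (palette-injective v
                   (trans (edge≡ p) (trans fe≡fe′ (sym (edge≡ q)))))))
               (edge-index (stars v) q)))

    missing : ∀ {v e} → Incident v e → miss v ≢ f e
    missing {v} p eq = 0≢1+n
      (palette-injective v {zero} {suc (index (stars v) p)} (trans eq (sym (edge≡ p))))

    colour : G⊕M.Edge → Fin _
    colour (inj₁ e)       = f e
    colour (inj₂ (e , _)) = miss (end₁ e)

    colour-copy : ∀ {v} (e : Σ[ e ∈ Edge ] T (M e)) →
      Incident v (proj₁ e) → colour (inj₂ e) ≡ miss v
    colour-copy _        (inj₁ refl) = refl
    colour-copy (_ , Me) (inj₂ refl) = miss-M Me

    colour-proper : G⊕M.ProperEdgeColouring colour
    colour-proper {e = inj₁ _} {inj₁ _} p q e≢e′ = proper p q (e≢e′ ∘ cong inj₁)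
    colour-proper {e = inj₁ _} {inj₂ e′} p q _ eq =
      missing p (trans (sym (colour-copy e′ q)) (sym eq))
    colour-proper {e = inj₂ e} {inj₁ _} p q _ eq =
      missing q (trans (sym (colour-copy e p)) eq)
    -- Two copies at one vertex stand for the same edge of the matching.
    colour-proper {e = inj₂ (e , Me)} {inj₂ (e′ , Me′)} p q e≢e′ _ =
      e≢e′ (cong (inj₂ ∘ proj₁)
        (copy-≡ {x = (e , Me) , p} {(e′ , Me′) , q}
          (trans (sym (partner-unique Me p)) (partner-unique Me′ q))))

-- Colours around a star

-- Which of the edges at b i, c i or d i lies in M: the link from the previous
-- star, the spoke to a i, or the link to the next star.
Role : Set
Role = Fin 3

pattern left   = 0F
pattern middle = 1F
pattern right  = 2F

-- The four colours between two stars, named from the second one: inˡ, inᵐ and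
-- inʳ (suc ρ for the role ρ) are those of the links arriving at the vertices with
-- role left, middle and right; spare is that of the copy of the link in M.
Slot : Set
Slot = Fin 4

pattern spare = 0F
pattern inˡ   = 1F
pattern inᵐ   = 2F
pattern inʳ   = 3F

Move : Set
Move = Fin 3

pattern alternate = 0F
pattern shift₁    = 1F
pattern shift₂    = 2F

-- The colours, in terms of the slots before the star, that a move gives at the
-- vertex with a given role: the one missing in G, those of the spoke and of the
-- link to the next star. All choices are of this kind, up to exchanging the
-- colour missing at the vertex with role right and that of its outgoing link, and
-- the colour missing at the centre and that of the spoke in M.
missing leg out : Move → Role → Slot
missing alternate = spare ∷ spare ∷ spare ∷ []
missing shift₁    = spare ∷ spare ∷ inᵐ   ∷ []
missing shift₂    = spare ∷ inˡ   ∷ inᵐ   ∷ []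

leg alternate = inʳ ∷ inˡ ∷ inᵐ   ∷ []
leg shift₁    = inᵐ ∷ inʳ ∷ inˡ   ∷ []
leg shift₂    = inᵐ ∷ inʳ ∷ spare ∷ []

out alternate = inᵐ ∷ inʳ   ∷ inˡ   ∷ []
out shift₁    = inʳ ∷ inˡ   ∷ spare ∷ []
out shift₂    = inʳ ∷ spare ∷ inˡ   ∷ []

injective? : ∀ {m n} (f : Fin m → Fin n) → Dec (∀ x y → f x ≡ f y → x ≡ y)
injective? f = all? λ x → all? λ y → (f x ≟ f y) →-dec (x ≟ y)

∀Bool? : ∀ {P : Bool → Set} → (∀ b → Dec (P b)) → Dec (∀ b → P b)
∀Bool? P? = map′ (λ { (t , f) true → t ; (t , f) false → f }) (λ h → h true , h false)
              (P? true ×-dec P? false)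

legSlots : Move → Role → Fin 4 → Slot
legSlots v ρ = missing v ρ ∷ suc ρ ∷ leg v ρ ∷ out v ρ ∷ []

-- The spoke in `M` leads to the vertex with role `middle`, so the centre has to miss the same
-- colour as that vertex.
hubSlots : Move → Fin 4 → Slot
hubSlots v = missing v middle ∷ leg v

legSlots-injective : ∀ v ρ x y → legSlots v ρ x ≡ legSlots v ρ y → x ≡ y
legSlots-injective = from-yes (all? λ v → all? λ ρ → injective? (legSlots v ρ))

hubSlots-injective : ∀ v x y → hubSlots v x ≡ hubSlots v y → x ≡ y
hubSlots-injective = from-yes (all? λ v → injective? (hubSlots v))

-- As suc ρ is the colour of the link arriving at role ρ of the next star, origin
-- gives the role of the other end of that link. The link in M goes from right to
-- left; the two remaining links admit just the two turns.
Turn : Set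
Turn = Bool

pattern back    = true
pattern forward = false

origin : Turn → Role → Role
origin back    = opposite
origin forward = right ∷ left ∷ middle ∷ []

-- Slots after the star, in terms of those before it. The new `spare` is missing at role `right`,
-- where the link in `M` leaves together with its copy.
step : Turn → Move → Slot → Slot
step w v = missing v right ∷ out v ∘ origin w

step-injective : ∀ w v x y → step w v x ≡ step w v y → x ≡ y
step-injective = from-yes (∀Bool? λ w → all? λ v → injective? (step w v))

-- The colours are the slots before star 0. New stars are composed on the inside because `step`
-- leads from later slots to earlier ones.
colourAfter : (ℕ → Turn) → (ℕ → Move) → ℕ → Slot → Fin 4
colourAfter w v zero    = id
colourAfter w v (suc j) = colourAfter w v j ∘ step (w j) (v j)

swap-if : Bool → Slot → Slot
swap-if true  = spare ∷ inˡ ∷ inʳ ∷ inᵐ ∷ []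
swap-if false = id

oddBacks : (ℕ → Turn) → ℕ → Bool
oddBacks w zero    = false
oddBacks w (suc j) = oddBacks w j xor w j

-- With `alternate`, turning `forward` is the identity on slots and turning `back` exchanges `inᵐ`
-- and `inʳ`, so only the parity of the backs survives.
swap-alternate : ∀ b w x → swap-if b (step w alternate x) ≡ swap-if (b xor w) x
swap-alternate = from-yes (∀Bool? λ b → ∀Bool? λ w → all? λ x →
  swap-if b (step w alternate x) ≟ swap-if (b xor w) x)

-- The moves were found by exhaustive search; the turn at the fourth star only
-- matters for whether a detour is needed.
detour : Turn → Turn → Turn → Bool → ℕ → Move
detour w₀ w₁ w₂ false = λ _ → alternate
detour w₀ w₁ w₂ true  = padded (moves w₀ w₁ w₂)
  where
  padded : (Fin 4 → Move) → ℕ → Move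
  padded v 0 = v 0F
  padded v 1 = v 1F
  padded v 2 = v 2F
  padded v 3 = v 3F
  padded v (suc (suc (suc (suc _)))) = alternate

  moves : Turn → Turn → Turn → Fin 4 → Move
  moves _       back    back    = alternate ∷ shift₁    ∷ shift₁    ∷ shift₁ ∷ []
  moves back    back    forward = shift₁    ∷ shift₁    ∷ alternate ∷ shift₁ ∷ []
  moves back    forward back    = shift₁    ∷ shift₁    ∷ alternate ∷ shift₁ ∷ []
  moves back    forward forward = shift₁    ∷ shift₁    ∷ shift₁    ∷ shift₂ ∷ []
  moves forward back    forward = shift₂    ∷ shift₁    ∷ shift₁    ∷ shift₁ ∷ []
  moves forward forward back    = shift₁    ∷ shift₂    ∷ shift₁    ∷ shift₁ ∷ []
  moves forward forward forward = shift₁    ∷ shift₁    ∷ shift₂    ∷ shift₁ ∷ []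

detour-alternate : ∀ w₀ w₁ w₂ b j → detour w₀ w₁ w₂ b (4 + j) ≡ alternate
detour-alternate w₀ w₁ w₂ true  j = refl
detour-alternate w₀ w₁ w₂ false j = refl

afterFour : Turn → Turn → Turn → Turn → (ℕ → Move) → Slot → Slot
afterFour w₀ w₁ w₂ w₃ v = step w₀ (v 0) ∘ step w₁ (v 1) ∘ step w₂ (v 2) ∘ step w₃ (v 3)

needsDetour : Turn → Turn → Turn → Turn → Bool → Bool
needsDetour w₀ w₁ w₂ w₃ t = w₀ xor w₁ xor w₂ xor w₃ xor t

-- Either the backs are even in number and their swaps cancel, or the special moves supply the
-- missing swap. Both cases are checked by evaluation.
detour-closes : ∀ w₀ w₁ w₂ w₃ t x →
  afterFour w₀ w₁ w₂ w₃ (detour w₀ w₁ w₂ (needsDetour w₀ w₁ w₂ w₃ t)) (swap-if t x) ≡ x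
detour-closes = from-yes (∀Bool? λ w₀ → ∀Bool? λ w₁ → ∀Bool? λ w₂ → ∀Bool? λ w₃ →
  ∀Bool? λ t → all? λ x →
  afterFour w₀ w₁ w₂ w₃ (detour w₀ w₁ w₂ (needsDetour w₀ w₁ w₂ w₃ t)) (swap-if t x) ≟ x)

-- Under `alternate`, the stars from the fifth on contribute at most one swap. Its parity depends on
-- the turns alone, so it is known when the first four moves are chosen to undo it.
closing-moves : ∀ w m → ∃[ v ] colourAfter w v (4 + m) ≗ id
closing-moves w m = v , λ x →
  trans (tail m x) (detour-closes (w 0) (w 1) (w 2) (w 3) (oddBacks w′ m) x)
  where
  w′ : ℕ → Turn
  w′ j = w (4 + j)

  detoured : Bool
  detoured = needsDetour (w 0) (w 1) (w 2) (w 3) (oddBacks w′ m)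

  v : ℕ → Move
  v = detour (w 0) (w 1) (w 2) detoured

  tail : ∀ j → colourAfter w v (4 + j) ≗ colourAfter w v 4 ∘ swap-if (oddBacks w′ j)
  tail zero    x = refl
  tail (suc j) x rewrite detour-alternate (w 0) (w 1) (w 2) detoured j =
    trans (tail j (step (w′ j) alternate x))
          (cong (colourAfter w v 4) (swap-alternate (oddBacks w′ j) (w′ j) x))

colourAfter-injective : ∀ w v j x y → colourAfter w v j x ≡ colourAfter w v j y → x ≡ y
colourAfter-injective w v zero    x y eq = eq
colourAfter-injective w v (suc j) x y eq =
  step-injective (w j) (v j) x y (colourAfter-injective w v j _ _ eq)

-- Turns of a perfect matching

-- The `suc n` values of `x ∷ g` collide. As `g` is injective, the collision involves `x`, which
-- thus lies in the image of `g`; so `g` is a two-sided inverse.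
section⇒injective : ∀ {n} {f g : Fin n → Fin n} → f ∘ g ≗ id → Injective _≡_ _≡_ f
section⇒injective {n} {f} {g} f∘g≗id {x} {y} fx≡fy =
  trans (sym (g∘f≗id x)) (trans (cong g fx≡fy) (g∘f≗id y))
  where
  g∘f≗id : g ∘ f ≗ id
  g∘f≗id x with pigeonhole (n<1+n n) (x ∷ g)
  ... | zero  , suc j , _   , eq = trans (cong (g ∘ f) eq) (trans (cong g (f∘g≗id j)) (sym eq))
  ... | suc i , suc j , i<j , eq = contradiction
          (cong suc (trans (sym (f∘g≗id i)) (trans (cong f eq) (f∘g≗id j)))) (<⇒≢ i<j)

Track : Set
Track = Fin 3

-- Tracks 0, 1, 2 are b, c, d: the link of track k arrives at track twist k.
twist : Track → Track
twist 0F = 0F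
twist 1F = 2F
twist 2F = 1F

twist-involutive : ∀ k → twist (twist k) ≡ k
twist-involutive 0F = refl
twist-involutive 1F = refl
twist-involutive 2F = refl

module Turns
  (role : ℕ → Track → Role) (axis : ℕ → Track)
  (role-axis     : ∀ j → role j (axis j) ≡ middle)
  (middle⇒axis   : ∀ {j k} → role j k ≡ middle → k ≡ axis j)
  (right⇒left    : ∀ {j k} → role j k ≡ right → role (suc j) (twist k) ≡ left)
  (left⇒right    : ∀ {j k} → role (suc j) (twist k) ≡ left → role j k ≡ right)
  -- The odd cycle of stars, unrolled over the natural numbers.
  (m : ℕ) (role-periodic : ∀ j → role (suc (m * 2) + j) ≗ role j)
  where

  NoLeft NoRight : ℕ → Set
  NoLeft  j = ∀ k → role j k ≢ left
  NoRight j = ∀ k → role j k ≢ right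

  NoRight⇒NoLeft : ∀ {j} → NoRight j → NoLeft (suc j)
  NoRight⇒NoLeft {j} noRight k eq = noRight (twist k)
    (left⇒right (trans (cong (role (suc j)) (twist-involutive k)) eq))

  -- With no left at j, every track but the axis is right at j, hence left at
  -- suc j after the twist; the axis at suc j takes the remaining track.
  NoLeft⇒NoRight : ∀ {j} → NoLeft j → NoRight (suc j)
  NoLeft⇒NoRight {j} noLeft k eq = absurd (role j (twist k)) refl
    where
    k≡ : twist (twist k) ≡ k
    k≡ = twist-involutive k

    other : ∀ l ρ → role j l ≡ ρ → l ≢ twist k → twist k ≡ axis j → role j l ≡ right
    other l left   p _  _ = contradiction p (noLeft l)
    other l middle p ne q = contradiction (trans (middle⇒axis p) (sym q)) ne
    other l right  p _  _ = p

    absurd : ∀ ρ → role j (twist k) ≢ ρ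
    absurd left   p = noLeft _ p
    absurd right  p with () ← trans (sym eq)
          (trans (cong (role (suc j)) (sym k≡)) (right⇒left p))
    absurd middle p with axis (suc j) ≟ k
    ... | yes refl with () ← trans (sym eq) (role-axis (suc j))
    ... | no  ax≢k with () ← trans (sym (role-axis (suc j)))
          (trans (cong (role (suc j)) (sym (twist-involutive (axis (suc j)))))
            (right⇒left (other (twist (axis (suc j))) _ refl
              (λ e → ax≢k (trans (sym (twist-involutive _)) (trans (cong twist e) k≡)))
              (middle⇒axis p))))

  -- The two implications alternate around the odd cycle and return to star `j` as `NoRight j`. Then
  -- all three tracks there have role `middle`, but only `axis j` can.
  some-left : ∀ j → ¬ NoLeft j
  some-left j noLeft = contradiction
    (trans (middle⇒axis (all-middle 0F)) (sym (middle⇒axis (all-middle 1F)))) λ ()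
    where
    propagate : ∀ i → NoLeft (i * 2 + j)
    propagate zero    = noLeft
    propagate (suc i) = NoRight⇒NoLeft (NoLeft⇒NoRight (propagate i))

    noRight : NoRight j
    noRight k eq = NoLeft⇒NoRight (propagate m) k (trans (role-periodic j k) eq)

    only-middle : ∀ {k} ρ → role j k ≡ ρ → role j k ≡ middle
    only-middle {k} left   p = contradiction p (noLeft k)
    only-middle     middle p = p
    only-middle {k} right  p = contradiction p (noRight k)

    all-middle : ∀ k → role j k ≡ middle
    all-middle k = only-middle _ refl

  role-surjective : ∀ j ρ → ∃[ k ] role j k ≡ ρ
  role-surjective j middle = axis j , role-axis j
  role-surjective j left   with ¬∀⟶∃¬ 3 _ (λ k → ¬? (role j k ≟ left)) (some-left j)
  ... | k , p = k , decidable-stable (role j k ≟ left) p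
  role-surjective j right  with ¬∀⟶∃¬ 3 _ (λ k → ¬? (role j k ≟ right))
                                  (some-left (suc j) ∘ NoRight⇒NoLeft)
  ... | k , p = k , decidable-stable (role j k ≟ right) p

  role-injective : ∀ j → Injective _≡_ _≡_ (role j)
  role-injective j = section⇒injective (proj₂ ∘ role-surjective j)

  IsTurn : ℕ → Turn → Set
  IsTurn j w = ∀ k → role j k ≡ origin w (role (suc j) (twist k))

  -- The link from `centre` arrives at role `middle`, so the role of `centre` is not `right`, whose
  -- link arrives at `left`. The choice between `middle` and `left` is the turn; injectivity settles
  -- the third link.
  turn : ∀ j → ∃[ w ] IsTurn j w
  turn j = by-centre _ refl
    where
    centre : Track
    centre = twist (axis (suc j))

    role-centre : role (suc j) (twist centre) ≡ middle
    role-centre = trans (cong (role (suc j)) (twist-involutive _)) (role-axis (suc j))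

    at-right : ∀ {k} ρ → role j k ≡ ρ → role (suc j) (twist k) ≡ right →
      ρ ≢ right × ρ ≢ role j centre
    at-right ρ p q =
      (λ { refl → contradiction (trans (sym q) (right⇒left p)) λ () }) ,
      (λ { refl → contradiction
        (trans (sym q) (trans (cong (role (suc j) ∘ twist) (role-injective j p)) role-centre)) λ () })

    centre-unique : ∀ {k} → role (suc j) (twist k) ≡ middle → k ≡ centre
    centre-unique p = trans (sym (twist-involutive _)) (cong twist (middle⇒axis p))

    by-centre : ∀ ρ → role j centre ≡ ρ → ∃[ w ] IsTurn j w
    by-centre right  p = contradiction (trans (sym role-centre) (right⇒left p)) λ ()
    by-centre middle p = back , λ k → case k _ refl _ refl
      where
      case : ∀ k ρ → role (suc j) (twist k) ≡ ρ → ∀ ρ′ → role j k ≡ ρ′ →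
        role j k ≡ origin back (role (suc j) (twist k))
      case k left   q _ _ = trans (left⇒right q) (cong (origin back) (sym q))
      case k middle q _ _ = trans (trans (cong (role j) (centre-unique q)) p)
                              (cong (origin back) (sym q))
      case k right  q right  p′ = contradiction refl (proj₁ (at-right _ p′ q))
      case k right  q middle p′ = contradiction (sym p) (proj₂ (at-right _ p′ q))
      case k right  q left   p′ = trans p′ (cong (origin back) (sym q))
    by-centre left   p = forward , λ k → case k _ refl _ refl
      where
      case : ∀ k ρ → role (suc j) (twist k) ≡ ρ → ∀ ρ′ → role j k ≡ ρ′ →
        role j k ≡ origin forward (role (suc j) (twist k))
      case k left   q _ _ = trans (left⇒right q) (cong (origin forward) (sym q))
      case k middle q _ _ = trans (trans (cong (role j) (centre-unique q)) p)
                              (cong (origin forward) (sym q))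
      case k right  q right  p′ = contradiction refl (proj₁ (at-right _ p′ q))
      case k right  q left   p′ = contradiction (sym p) (proj₂ (at-right _ p′ q))
      case k right  q middle p′ = trans p′ (cong (origin forward) (sym q))

-- Flower snarks

module Cyclic (n′ : ℕ) where
  n : ℕ
  n = suc n′

  at : ℕ → Fin n
  at j = j mod n

  toℕ-at : ∀ j → toℕ (at j) ≡ j % n
  toℕ-at j = toℕ-fromℕ< (m%n<n j n)

  at-cong : ∀ {j k} → j % n ≡ k % n → at j ≡ at k
  at-cong {j} {k} eq = toℕ-injective (trans (toℕ-at j) (trans eq (sym (toℕ-at k))))

  at-toℕ : ∀ i → at (toℕ i) ≡ i
  at-toℕ i = toℕ-injective (trans (toℕ-at (toℕ i)) (m<n⇒m%n≡m (toℕ<n i)))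

  at-+ : ∀ j k → at (j + toℕ (at k)) ≡ at (j + k)
  at-+ j k = at-cong {j + toℕ (at k)} {j + k} (begin
    (j + toℕ (at k)) % n        ≡⟨ cong (λ x → (j + x) % n) (toℕ-at k) ⟩
    (j + k % n) % n             ≡⟨ %-distribˡ-+ j (k % n) n ⟩
    (j % n + k % n % n) % n     ≡⟨ cong (λ x → (j % n + x) % n) (m%n%n≡m%n k n) ⟩
    (j % n + k % n) % n         ≡⟨ %-distribˡ-+ j k n ⟨
    (j + k) % n                 ∎)
    where open ≡-Reasoning

  at-n+ : ∀ j → at (n + j) ≡ at j
  at-n+ j = at-cong {n + j} {j} (trans (cong (_% n) (+-comm n j)) ([m+n]%n≡m%n j n))

  prev : Fin n → Fin n
  prev i = at (n′ + toℕ i)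

  next-prev : ∀ i → next (prev i) ≡ i
  next-prev i = trans (at-+ 1 (n′ + toℕ i)) (trans (at-n+ (toℕ i)) (at-toℕ i))

  prev-next : ∀ i → prev (next i) ≡ i
  prev-next i = trans (at-+ n′ (suc (toℕ i)))
    (trans (cong at (+-suc n′ (toℕ i))) (trans (at-n+ (toℕ i)) (at-toℕ i)))

  toℕ-next : ∀ i → toℕ (next i) ≡ suc (toℕ i) ⊎ (toℕ (next i) ≡ 0 × suc (toℕ i) ≡ n)
  toℕ-next i with m≤n⇒m<n∨m≡n (toℕ<n i)
  ... | inj₁ 1+i<n = inj₁ (trans (toℕ-at (suc (toℕ i))) (m<n⇒m%n≡m 1+i<n))
  ... | inj₂ 1+i≡n = inj₂
    (trans (toℕ-at (suc (toℕ i))) (trans (cong (_% n) 1+i≡n) (n%n≡0 n)) , 1+i≡n)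

  next-at : ∀ j → next (at j) ≡ at (suc j)
  next-at = at-+ 1

module Snark (n′ : ℕ) (3≤n : 3 ≤ suc n′) where
  open Cyclic n′

  F : Multigraph
  F = flowerSnark n 3≤n

  open Multigraph F using (Vertex; Edge; end₁; end₂; Incident)
  open Colouring F

  legAt : Track → Fin n → Vertex
  legAt 0F = b
  legAt 1F = c
  legAt 2F = d

  spoke link : Track → Fin n → Edge
  spoke 0F = ab
  spoke 1F = ac
  spoke 2F = ad
  link 0F = bb
  link 1F = cd
  link 2F = dc

  spokes : Fin n → Track → Edge
  spokes i k = spoke k i

  -- Listed in the order of roles, so that the index of the edge in `M` is the role itself.
  around : Track → Fin n → Role → Edge
  around k i = link (twist k) (prev i) ∷ spoke k i ∷ link k i ∷ []

  edgesAt : Vertex → Fin 3 → Edge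
  edgesAt (a i) = spokes i
  edgesAt (b i) = around 0F i
  edgesAt (c i) = around 1F i
  edgesAt (d i) = around 2F i

  edgesAt-legAt : ∀ k i → edgesAt (legAt k i) ≡ around k i
  edgesAt-legAt 0F i = refl
  edgesAt-legAt 1F i = refl
  edgesAt-legAt 2F i = refl

  position₁ position₂ : Edge → Fin 3

  position₁ (ab _) = 0F
  position₁ (ac _) = 1F
  position₁ (ad _) = 2F
  position₁ (bb _) = right
  position₁ (cd _) = right
  position₁ (dc _) = right

  position₂ (ab _) = middle
  position₂ (ac _) = middle
  position₂ (ad _) = middle
  position₂ (bb _) = left
  position₂ (cd _) = left
  position₂ (dc _) = left

  edgesAt-end₁ : ∀ e → edgesAt (end₁ e) (position₁ e) ≡ e
  edgesAt-end₁ (ab _) = refl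
  edgesAt-end₁ (ac _) = refl
  edgesAt-end₁ (ad _) = refl
  edgesAt-end₁ (bb _) = refl
  edgesAt-end₁ (cd _) = refl
  edgesAt-end₁ (dc _) = refl

  edgesAt-end₂ : ∀ e → edgesAt (end₂ e) (position₂ e) ≡ e
  edgesAt-end₂ (ab _) = refl
  edgesAt-end₂ (ac _) = refl
  edgesAt-end₂ (ad _) = refl
  edgesAt-end₂ (bb i) = cong bb (prev-next i)
  edgesAt-end₂ (cd i) = cong cd (prev-next i)
  edgesAt-end₂ (dc i) = cong dc (prev-next i)

  star : ∀ v → EdgesAt v 3
  star v = record
    { edge       = edgesAt v
    ; incident   = incident′ v
    ; index      = index′
    ; edge-index = edge-index′
    ; index-edge = index-edge′ v
    }
    where
    incident′ : ∀ v i → Incident v (edgesAt v i)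
    incident′ (a i) 0F     = inj₁ refl
    incident′ (a i) 1F     = inj₁ refl
    incident′ (a i) 2F     = inj₁ refl
    incident′ (b i) left   = inj₂ (cong b (sym (next-prev i)))
    incident′ (b i) middle = inj₂ refl
    incident′ (b i) right  = inj₁ refl
    incident′ (c i) left   = inj₂ (cong c (sym (next-prev i)))
    incident′ (c i) middle = inj₂ refl
    incident′ (c i) right  = inj₁ refl
    incident′ (d i) left   = inj₂ (cong d (sym (next-prev i)))
    incident′ (d i) middle = inj₂ refl
    incident′ (d i) right  = inj₁ refl

    index′ : ∀ {v e} → Incident v e → Fin 3
    index′ {e = e} (inj₁ _) = position₁ e
    index′ {e = e} (inj₂ _) = position₂ e

    edge-index′ : ∀ {v e} (p : Incident v e) → edgesAt v (index′ p) ≡ e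
    edge-index′ {e = e} (inj₁ refl) = edgesAt-end₁ e
    edge-index′ {e = e} (inj₂ refl) = edgesAt-end₂ e

    index-edge′ : ∀ v i → index′ (incident′ v i) ≡ i
    index-edge′ (a i) 0F     = refl
    index-edge′ (a i) 1F     = refl
    index-edge′ (a i) 2F     = refl
    index-edge′ (b i) left   = refl
    index-edge′ (b i) middle = refl
    index-edge′ (b i) right  = refl
    index-edge′ (c i) left   = refl
    index-edge′ (c i) middle = refl
    index-edge′ (c i) right  = refl
    index-edge′ (d i) left   = refl
    index-edge′ (d i) middle = refl
    index-edge′ (d i) right  = refl

  -- Colouring the snark from roles, turns and moves

  module Coloured
    (role : Fin n → Track → Role) (role-injective : ∀ i → Injective _≡_ _≡_ (role i))
    (w : ℕ → Turn) (role-next : ∀ i k → role i k ≡ origin (w (toℕ i)) (role (next i) (twist k)))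
    (v : ℕ → Move) (closed : colourAfter w v n ≗ id)
    where

    hue : ℕ → Slot → Fin 4
    hue = colourAfter w v

    -- Only the last star needs an argument: there `closed` identifies the colours after `n` stars
    -- with those at the start.
    hue-next : ∀ i → hue (toℕ (next i)) ≗ hue (suc (toℕ i))
    hue-next i x with toℕ-next i
    ... | inj₁ eq = cong (λ j → hue j x) eq
    ... | inj₂ (eq , 1+i≡n) = begin
      hue (toℕ (next i)) x ≡⟨ cong (λ j → hue j x) eq ⟩
      x                    ≡⟨ closed x ⟨
      hue n x              ≡⟨ cong (λ j → hue j x) 1+i≡n ⟨
      hue (suc (toℕ i)) x  ∎
      where open ≡-Reasoning

    spokeColour linkColour missColour : Track → Fin n → Fin 4
    spokeColour k i = hue (toℕ i) (leg (v (toℕ i)) (role i k))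
    linkColour  k i = hue (toℕ i) (out (v (toℕ i)) (role i k))
    missColour  k i = hue (toℕ i) (missing (v (toℕ i)) (role i k))

    colour : Edge → Fin 4
    colour (ab i) = spokeColour 0F i
    colour (ac i) = spokeColour 1F i
    colour (ad i) = spokeColour 2F i
    colour (bb i) = linkColour 0F i
    colour (cd i) = linkColour 1F i
    colour (dc i) = linkColour 2F i

    miss : Vertex → Fin 4
    miss (a i) = hue (toℕ i) (missing (v (toℕ i)) middle)
    miss (b i) = missColour 0F i
    miss (c i) = missColour 1F i
    miss (d i) = missColour 2F i

    colour-spoke : ∀ k i → colour (spoke k i) ≡ spokeColour k i
    colour-spoke 0F i = refl
    colour-spoke 1F i = refl
    colour-spoke 2F i = refl

    colour-link : ∀ k i → colour (link k i) ≡ linkColour k i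
    colour-link 0F i = refl
    colour-link 1F i = refl
    colour-link 2F i = refl

    colour-link-prev : ∀ k i → colour (link (twist k) (prev i)) ≡ hue (toℕ i) (suc (role i k))
    colour-link-prev k i = begin
      colour (link (twist k) h)
        ≡⟨ colour-link (twist k) h ⟩
      hue (toℕ h) (out (v (toℕ h)) (role h (twist k)))
        -- Once the role is written through `origin`, the colour computes to `step` at an incoming
        -- slot.
        ≡⟨ cong (hue (toℕ h) ∘ out (v (toℕ h))) (role-next h (twist k)) ⟩
      hue (suc (toℕ h)) (suc (role (next h) (twist (twist k))))
        ≡⟨ hue-next h (suc (role (next h) (twist (twist k)))) ⟨
      hue (toℕ (next h)) (suc (role (next h) (twist (twist k))))
        ≡⟨ cong₂ (λ i k → hue (toℕ i) (suc (role i k))) (next-prev i) (twist-involutive k) ⟩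
      hue (toℕ i) (suc (role i k))
        ∎
      where
      open ≡-Reasoning
      h = prev i

    leg-palette : ∀ k i →
      missColour k i ∷ colour ∘ around k i ≗ hue (toℕ i) ∘ legSlots (v (toℕ i)) (role i k)
    leg-palette k i 0F = refl
    leg-palette k i 1F = colour-link-prev k i
    leg-palette k i 2F = colour-spoke k i
    leg-palette k i 3F = colour-link k i

    leg-palette-injective : ∀ k i → Injective _≡_ _≡_ (missColour k i ∷ colour ∘ around k i)
    leg-palette-injective k i {x} {y} eq =
      legSlots-injective (v (toℕ i)) (role i k) x y
        (colourAfter-injective w v (toℕ i) (slots x) (slots y)
          (trans (sym (leg-palette k i x)) (trans eq (leg-palette k i y))))
      where
      slots : Fin 4 → Slot
      slots = legSlots (v (toℕ i)) (role i k)

    hub-palette : ∀ i →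
      miss (a i) ∷ colour ∘ spokes i ≗ hue (toℕ i) ∘ hubSlots (v (toℕ i)) ∘ (0F ∷ suc ∘ role i)
    hub-palette i 0F      = refl
    hub-palette i (suc k) = colour-spoke k i

    hub-palette-injective : ∀ i → Injective _≡_ _≡_ (miss (a i) ∷ colour ∘ spokes i)
    hub-palette-injective i {x} {y} eq = relabel-injective x y
      (hubSlots-injective (v (toℕ i)) (relabel x) (relabel y)
        (colourAfter-injective w v (toℕ i) _ _
          (trans (sym (hub-palette i x)) (trans eq (hub-palette i y)))))
      where
      relabel : Fin 4 → Fin 4
      relabel = 0F ∷ suc ∘ role i

      relabel-injective : ∀ x y → relabel x ≡ relabel y → x ≡ y
      relabel-injective zero    zero    _  = refl
      relabel-injective zero    (suc _) ()
      relabel-injective (suc _) zero    ()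
      relabel-injective (suc x) (suc y) eq = cong suc (role-injective i (suc-injective eq))

    palette-injective : ∀ v → Injective _≡_ _≡_ (miss v ∷ colour ∘ edgesAt v)
    palette-injective (a i) = hub-palette-injective i
    palette-injective (b i) = leg-palette-injective 0F i
    palette-injective (c i) = leg-palette-injective 1F i
    palette-injective (d i) = leg-palette-injective 2F i

    -- The link in `M` arriving at role `left` has its copy coloured `spare`, so every move must
    -- leave `spare` missing there.
    missing-left : ∀ m → missing m left ≡ spare
    missing-left alternate = refl
    missing-left shift₁ = refl
    missing-left shift₂ = refl

    miss-spoke : ∀ k i → role i k ≡ middle → miss (a i) ≡ missColour k i
    miss-spoke k i eq = cong (hue (toℕ i) ∘ missing (v (toℕ i))) (sym eq)

    miss-link : ∀ k i → role i k ≡ right → role (next i) (twist k) ≡ left →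
      missColour k i ≡ missColour (twist k) (next i)
    miss-link k i k-right k-left = begin
      hue (toℕ i) (missing (v (toℕ i)) (role i k))
        ≡⟨ cong (hue (toℕ i) ∘ missing (v (toℕ i))) k-right ⟩
      hue (suc (toℕ i)) spare
        ≡⟨ hue-next i spare ⟨
      hue (toℕ (next i)) spare
        ≡⟨ cong (hue (toℕ (next i))) (missing-left (v (toℕ (next i)))) ⟨
      hue (toℕ (next i)) (missing (v (toℕ (next i))) left)
        ≡⟨ cong (hue (toℕ (next i)) ∘ missing (v (toℕ (next i)))) k-left ⟨
      missColour (twist k) (next i)
        ∎
      where open ≡-Reasoning

  -- Roles and turns of a given perfect matching

  module Matched (M : EdgeSet F) (pm : PerfectMatching F M) (m : ℕ) (n≡ : n ≡ 5 + m * 2) where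
    open Doubling F M pm

    role : Fin n → Track → Role
    role i k = mate (star (legAt k i))

    axis : Fin n → Track
    axis i = mate (star (a i))

    role-M : ∀ {i k ρ} → role i k ≡ ρ → T (M (around k i ρ))
    role-M {i} {k} refl = subst (λ es → T (M (es (role i k)))) (edgesAt-legAt k i)
                            (mate-M (star (legAt k i)))

    M-role : ∀ {i k ρ} → T (M (around k i ρ)) → role i k ≡ ρ
    M-role {i} {k} {ρ} Mρ = sym (mate-unique (star (legAt k i))
      (subst (λ es → T (M (es ρ))) (sym (edgesAt-legAt k i)) Mρ))

    around-next-left : ∀ k i → around (twist k) (next i) left ≡ link k i
    around-next-left k i = cong₂ link (twist-involutive k) (prev-next i)

    right⇒left : ∀ {i k} → role i k ≡ right → role (next i) (twist k) ≡ left
    right⇒left {i} {k} eq =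
      M-role (subst (T ∘ M) (sym (around-next-left k i)) (role-M {ρ = right} eq))

    left⇒right : ∀ {i k} → role (next i) (twist k) ≡ left → role i k ≡ right
    left⇒right {i} {k} eq =
      M-role {ρ = right} (subst (T ∘ M) (around-next-left k i) (role-M {ρ = left} eq))

    open Turns (role ∘ at) (axis ∘ at)
      (λ j → M-role {ρ = middle} (mate-M (star (a (at j)))))
      (λ {j} eq → mate-unique (star (a (at j))) (role-M {ρ = middle} eq))
      (λ {j} {k} eq → trans (cong (λ i → role i (twist k)) (sym (next-at j))) (right⇒left eq))
      (λ {j} {k} eq → left⇒right (trans (cong (λ i → role i (twist k)) (next-at j)) eq))
      -- The period `suc ((2 + m) * 2)` computes to `5 + m * 2`.
      (2 + m)
      (λ j k → cong (λ i → role i k) (trans (cong (λ x → at (x + j)) (sym n≡)) (at-n+ j)))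

    turnAt : ℕ → Turn
    turnAt j = proj₁ (turn j)

    role-next : ∀ i k → role i k ≡ origin (turnAt (toℕ i)) (role (next i) (twist k))
    role-next i k = trans (cong (λ i → role i k) (sym (at-toℕ i))) (proj₂ (turn (toℕ i)) k)

    role-injective-Fin : ∀ i → Injective _≡_ _≡_ (role i)
    role-injective-Fin i = subst (λ i → Injective _≡_ _≡_ (role i)) (at-toℕ i) (role-injective (toℕ i))

    closing : ∃[ v ] colourAfter turnAt v n ≗ id
    closing = subst (λ n → ∃[ v ] colourAfter turnAt v n ≗ id) (sym n≡)
                -- Four of the `5 + m * 2` stars are reserved for the detour.
                (closing-moves turnAt (suc (m * 2)))

    open Coloured role role-injective-Fin turnAt role-next (proj₁ closing) (proj₂ closing)

    M-miss-link : ∀ k i → T (M (link k i)) → missColour k i ≡ missColour (twist k) (next i)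
    M-miss-link k i Me = miss-link k i k-right (right⇒left k-right)
      where
      k-right : role i k ≡ right
      k-right = M-role {ρ = right} Me

    miss-M : ∀ {e} → T (M e) → miss (end₁ e) ≡ miss (end₂ e)
    miss-M {ab i} Me = miss-spoke 0F i (M-role {ρ = middle} Me)
    miss-M {ac i} Me = miss-spoke 1F i (M-role {ρ = middle} Me)
    miss-M {ad i} Me = miss-spoke 2F i (M-role {ρ = middle} Me)
    miss-M {bb i} Me = M-miss-link 0F i Me
    miss-M {cd i} Me = M-miss-link 1F i Me
    miss-M {dc i} Me = M-miss-link 2F i Me

    classI : ClassI (F ⊕ M)
    -- Three edges and one copy at each vertex make `F ⊕ M` 4-regular.
    classI = Colouring.regular⇒ClassI (F ⊕ M) (a 0F) (λ v → hasDegree-⊕ (hasDegree (star v)))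
               (colourable-⊕ star colour miss palette-injective miss-M)

odd≥5 : ∀ n → 5 ≤ n → n % 2 ≡ 1 → ∃[ m ] n ≡ 5 + m * 2
odd≥5 n 5≤n odd with n / 2 | trans (m≡m%n+[m/n]*n n 2) (cong (_+ n / 2 * 2) odd)
... | suc (suc m) | eq = m , eq
-- Quotients 0 and 1 would make `n` equal to 1 or 3.
odd≥5 _ (s≤s ())             _ | 0 | refl
odd≥5 _ (s≤s (s≤s (s≤s ()))) _ | 1 | refl

theorem4p4 : (n : ℕ) (5≤n : 5 ≤ n) → n % 2 ≡ 1 →
    let F = flowerSnark n (≤-trans (m≤n+m 3 2) 5≤n) in
    (M : EdgeSet F) → PerfectMatching F M → ClassI (F ⊕ M)
theorem4p4 n 5≤n odd M pm with odd≥5 n 5≤n odd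
... | m , refl = Snark.Matched.classI (4 + m * 2) (≤-trans (m≤n+m 3 2) 5≤n) M pm m refl
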